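{- Let $\Gamma=a_1\Gamma_1+a_2\mathbb{N}$ be a gluing of numerical semigroups, and let $z$ be an integer. Express $z$ as $z=a_1\alpha+a_2\beta$ with $0\leq \beta<a_1$ and $\alpha,\beta\in\mathbb{Z}$. Then: (1) $\operatorname{Ap}(\Gamma,z)=\big(a_1\operatorname{Ap}(\Gamma_1,\alpha+a_2)+a_2\{0,\ldots,\beta-1\}\big)\cup\big(a_1\operatorname{Ap}(\Gamma_1,\alpha)+a_2\{\beta,\ldots,a_1-1\}\big)$; (2) $\mathrm D_\Gamma(z)=\big(a_1\mathrm D_{\Gamma_1}(\alpha)+a_2\{0,\ldots,\beta\}\big)\cup \big(a_1\mathrm D_{\Gamma_1}(\alpha-a_2)+a_2\{\beta+1,\ldots,a_1-1\}\big)$; (3) $\#\operatorname{Ap}(\Gamma,z)=\beta\cdot\#\operatorname{Ap}(\Gamma_1,\alpha+a_2)+(a_1-\beta)\cdot\#\operatorname{Ap}(\Gamma_1,\alpha)$; (4) $\#\mathrm D_\Gamma(z)=(\beta+1)\cdot\#\mathrm D_{\Gamma_1}(\alpha)+(a_1-\beta-1)\cdot\#\mathrm D_{\Gamma_1}(\alpha-a_2)$.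
   Context: $\mathbb N$ denotes the non-negative integers. A numerical semigroup is a set $\langle n_1,\dots,n_m\rangle:=n_1\mathbb N+\cdots+n_m\mathbb N$ with $n_i$ positive integers and $\gcd(n_1,\dots,n_m)=1$. The minimal generators of $\Gamma$ are the elements of its unique minimal generating set. For $x\in\mathbb Z$, the Apéry set is $\operatorname{Ap}(\Gamma,x)=\{a\in\Gamma\mid a-x\notin\Gamma\}$, and the set of divisors is $\mathrm D_\Gamma(x)=\{c\in\Gamma\mid x-c\in\Gamma\}$. Gluing: given numerical semigroups $\Gamma_1,\Gamma_2$, $a_1\in\Gamma_2$ and $a_2\in\Gamma_1$ with $\gcd(a_1,a_2)=1$, $a_1$ not a minimal generator of $\Gamma_2$ and $a_2$ not a minimal generator of $\Gamma_1$, the numerical semigroup $a_1\Gamma_1+a_2\Gamma_2$ is called a gluing of $\Gamma_1$ and $\Gamma_2$. Here $\Gamma_2=\mathbb N$. For sets of integers $X,Y$ and an integer $a$: $aX=\{ax\mid x\in X\}$ and $X+Y=\{x+y\mid x\in X,y\in Y\}$ (empty if either is empty); $\{u,\dots,v\}$ is empty if $u>v$. -}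

module Defs where

open import Data.Integer.Base using (ℤ; +_; 0ℤ; 1ℤ; _+_; _-_; _*_; _≤_; Positive)
open import Data.Integer.GCD using (gcd)
open import Data.List.Base using (List; []; _∷_; foldr; length)
open import Data.List.Membership.Propositional using () renaming (_∈_ to _∈ˡ_)
open import Data.List.Membership.Propositional.Properties.WithK using (unique∧set⇒bag)
open import Data.List.Relation.Binary.BagAndSetEquality using (∼bag⇒↭)
open import Data.List.Relation.Binary.Permutation.Propositional.Properties using (↭-length)
open import Data.List.Relation.Unary.All using (All)
open import Data.List.Relation.Unary.Unique.Propositional using (Unique)
open import Data.Nat.Base using (ℕ)
open import Data.Product.Base using (∃-syntax; _×_)
open import Function.Bundles using (_⇔_)
open import Function.Construct.Composition using (_⇔-∘_)
open import Function.Construct.Symmetry using (⇔-sym)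
open import Level using (0ℓ)
open import Relation.Binary.PropositionalEquality using (_≡_; trans; sym)
open import Relation.Unary using (Pred; _∈_; _∉_; _⊆_; _≐_; ｛_｝)

ℤSet : Set₁
ℤSet = Pred ℤ 0ℓ

infixr 7 _·_
infixl 6 _⊕_

_·_ : ℤ → ℤSet → ℤSet
(a · X) y = ∃[ x ] x ∈ X × y ≡ a * x

_⊕_ : ℤSet → ℤSet → ℤSet
(X ⊕ Y) z = ∃[ x ] ∃[ y ] x ∈ X × y ∈ Y × z ≡ x + y

[_⋯_] : ℤ → ℤ → ℤSet
[ u ⋯ v ] x = u ≤ x × x ≤ v

-- The non-negative integers, as a set of integers.
𝐍 : ℤSet
𝐍 x = 0ℤ ≤ x

⟨_⟩ : List ℤ → ℤSet
⟨ [] ⟩     = ｛ 0ℤ ｝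
⟨ n ∷ ns ⟩ = n · 𝐍 ⊕ ⟨ ns ⟩

IsNumericalSemigroup : ℤSet → Set
IsNumericalSemigroup Γ =
  ∃[ ns ] All Positive ns × foldr gcd 0ℤ ns ≡ 1ℤ × Γ ≐ ⟨ ns ⟩

-- Lists are read as finite sets here: order and repetitions are irrelevant.
IsMinimalGeneratingSet : ℤSet → List ℤ → Set
IsMinimalGeneratingSet Γ ns =
  Γ ≐ ⟨ ns ⟩ ×
  (∀ ms → (_∈ˡ ms) ⊆ (_∈ˡ ns) → Γ ≐ ⟨ ms ⟩ → (_∈ˡ ns) ⊆ (_∈ˡ ms))

MinimalGenerators : ℤSet → ℤSet
MinimalGenerators Γ x = ∃[ ns ] IsMinimalGeneratingSet Γ ns × x ∈ˡ ns

record IsGluing (Γ : ℤSet) (a₁ : ℤ) (Γ₁ : ℤSet) (a₂ : ℤ) (Γ₂ : ℤSet) : Set where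
  field
    isNumericalSemigroup₁ : IsNumericalSemigroup Γ₁
    isNumericalSemigroup₂ : IsNumericalSemigroup Γ₂
    a₁∈Γ₂                 : a₁ ∈ Γ₂
    a₂∈Γ₁                 : a₂ ∈ Γ₁
    coprime               : gcd a₁ a₂ ≡ 1ℤ
    a₁-notMinimal         : a₁ ∉ MinimalGenerators Γ₂
    a₂-notMinimal         : a₂ ∉ MinimalGenerators Γ₁
    isSum                 : Γ ≐ a₁ · Γ₁ ⊕ a₂ · Γ₂

Ap : ℤSet → ℤ → ℤSet
Ap Γ x a = a ∈ Γ × a - x ∉ Γ

D : ℤSet → ℤ → ℤSet
D Γ x c = c ∈ Γ × x - c ∈ Γ

-- X is finite with exactly n elements.
record HasCardinality (X : ℤSet) (n : ℕ) : Set where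
  field
    elements : List ℤ
    unique   : Unique elements
    complete : ∀ {x} → x ∈ X ⇔ x ∈ˡ elements
    size     : length elements ≡ n

-- So "#X" is unambiguous, and an equation between cardinalities may be
-- stated by exhibiting them.
cardinality-unique : ∀ {X m n} → HasCardinality X m → HasCardinality X n → m ≡ n
cardinality-unique p q =
  trans (sym P.size) (trans (↭-length (∼bag⇒↭ (unique∧set⇒bag P.unique Q.unique
    (Q.complete ⇔-∘ ⇔-sym P.complete)))) Q.size)
  where
  module P = HasCardinality p
  module Q = HasCardinality q

{-# OPTIONS --safe #-}
module Submission where

-- Since a₁ and a₂ are coprime, every element of Γ is uniquely a₁ x + a₂ y with
-- 0 ≤ y < a₁, and for such y the integer a₁ x + a₂ y lies in Γ iff x lies in Γ₁:
-- another representation a₁ x′ + a₂ y′ with y′ ≥ 0 has y′ = y + t a₁ and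
-- x = x′ + t a₂ with t ≥ 0, and a₂ ∈ Γ₁.  Bringing c − z and z − c to this form,
-- membership of c in Ap(Γ, z) and D(Γ, z) becomes a condition on x that depends
-- only on the position of y relative to β.  The cardinalities follow by
-- uniqueness; constructively they also need Γ₁ to be decidable with an explicit
-- conductor, which a Bézout identity for the generators provides.

open import Defs
open import Data.Integer.Base using (ℤ; +_; -[1+_]; +[1+_]; 0ℤ; 1ℤ; -1ℤ; _+_; _-_; _*_; _≤_; _<_; ∣_∣; +≤+; -≤+; +<+;
  NonZero; Positive; nonNegative; >-nonZero)
open import Data.Integer.Coprimality using (coprime-divisor)
open import Data.Integer.Divisibility.Signed using (_∣_; divides; ∣ᵤ⇒∣; ∣⇒∣ᵤ)
open import Data.Integer.DivMod using (_/_; _%_; _/ℕ_; _%ℕ_; n%d<d; n%ℕd<d; a≡a%n+[a/n]*n; a≡a%ℕn+[a/ℕn]*n)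
open import Data.Integer.GCD using (gcd)
open import Data.Integer.Properties
open import Algebra.Properties.AbelianGroup +-0-abelianGroup
  using () renaming (∙-cancelˡ to +-cancelˡ; ∙-cancelʳ to +-cancelʳ)
open import Data.Integer.Tactic.RingSolver using (solve-∀)
open import Data.List.Base using (List; []; _∷_; _++_; foldr; length; map; filter; upTo; cartesianProduct)
open import Data.List.Membership.Propositional using () renaming (_∈_ to _∈ˡ_)
open import Data.List.Membership.Propositional.Properties
  using (∈-map⁺; ∈-map⁻; ∈-++⁺ˡ; ∈-++⁺ʳ; ∈-++⁻; ∈-filter⁺; ∈-filter⁻; ∈-upTo⁺; ∈-upTo⁻; ∈-cartesianProduct⁺; ∈-cartesianProduct⁻)
open import Data.List.Properties using (length-map; length-++; length-upTo)
open import Data.List.Relation.Unary.All as All using (All; []; _∷_)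
import Data.List.Relation.Unary.All.Properties as All
open import Data.List.Relation.Unary.AllPairs using ([]; _∷_)
open import Data.List.Relation.Unary.Any using (here; there)
open import Data.List.Relation.Unary.Unique.Propositional using (Unique)
import Data.List.Relation.Unary.Unique.Propositional.Properties as Unique
open import Data.Nat.Base as ℕ using (ℕ; z≤n; s≤s)
open import Data.Nat.Coprimality using (gcd≡1⇒coprime)
open import Data.Nat.GCD using (module Bézout; gcd-GCD)
import Data.Nat.Properties as ℕ
open import Data.Product.Base using (∃-syntax; _×_; _,_; proj₁; proj₂)
open import Data.Product.Function.NonDependent.Propositional using (_×-⇔_)
open import Data.Sum.Base using (inj₁; inj₂; [_,_])
open import Function.Base using (_∘_)
open import Function.Bundles using (_⇔_; mk⇔; module Equivalence)
open import Function.Construct.Composition using (_⇔-∘_)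
open import Function.Related.TypeIsomorphisms using (¬-cong-⇔)
open import Relation.Binary.PropositionalEquality using (_≡_; refl; sym; trans; cong; cong₂; subst; subst₂; module ≡-Reasoning)
open import Relation.Nullary using (yes; no; contradiction)
open import Relation.Nullary.Decidable using (map′; ¬?; _×-dec_)
open import Relation.Unary using (_≐_; _∪_; _∈_; _∉_; _⊆_; Decidable)

private variable
  X Y X₀ X₁ : ℤSet
  k l m n : ℕ

-- Linear inequalities are derived by exhibiting equal differences, so that the
-- side condition is a ring identity.
≤-shift : ∀ {i j i′ j′} → i ≤ j → j - i ≡ j′ - i′ → i′ ≤ j′
≤-shift i≤j eq = 0≤i-j⇒j≤i (subst (0ℤ ≤_) eq (i≤j⇒0≤j-i i≤j))

i<j⇒i≤j-1 : ∀ {i j} → i < j → i ≤ j - 1ℤ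
i<j⇒i≤j-1 {j = j} i<j = subst (_ ≤_) (+-comm -1ℤ j) (i<j⇒i≤pred[j] i<j)

i≤j-1⇒i<j : ∀ {i j} → i ≤ j - 1ℤ → i < j
i≤j-1⇒i<j {j = j} i≤ = i≤pred[j]⇒i<j (subst (_ ≤_) (+-comm j -1ℤ) i≤)

<-shift : ∀ {i j i′ j′} → i < j → j - i ≡ j′ - i′ → i′ < j′
<-shift {i} {j} {i′} {j′} i<j eq = i≤j-1⇒i<j
  (≤-shift (i<j⇒i≤j-1 i<j) (trans (ident i j) (trans (cong (_- 1ℤ) eq) (sym (ident i′ j′)))))
  where
  ident : ∀ i j → j - 1ℤ - i ≡ j - i - 1ℤ
  ident = solve-∀

0≤i*j : ∀ {i j} → 0ℤ ≤ i → 0ℤ ≤ j → 0ℤ ≤ i * j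
0≤i*j {i} {j} 0≤i 0≤j = subst (_≤ i * j) (*-zeroʳ i) (*-monoˡ-≤-nonNeg i {{nonNegative 0≤i}} 0≤j)

i≤+∣i∣ : ∀ i → i ≤ + ∣ i ∣
i≤+∣i∣ (+ n)    = ≤-refl
i≤+∣i∣ -[1+ n ] = -≤+

-- Finite cardinalities

length-cartesianProduct : ∀ {A B : Set} (xs : List A) (ys : List B) →
  length (cartesianProduct xs ys) ≡ length xs ℕ.* length ys
length-cartesianProduct []       ys = refl
length-cartesianProduct (x ∷ xs) ys = trans (length-++ (map (x ,_) ys))
  (cong₂ ℕ._+_ (length-map (x ,_) ys) (length-cartesianProduct xs ys))

-- Injectivity is asked only on the entries: the map sending (x, y) to a₁ x + a₂ y, to which this is
-- applied, identifies pairs as soon as y is unrestricted.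
map⁺-local : ∀ {A B : Set} {f : A → B} {xs} →
  (∀ {x y} → x ∈ˡ xs → y ∈ˡ xs → f x ≡ f y → x ≡ y) → Unique xs → Unique (map f xs)
map⁺-local inj []         = []
map⁺-local inj (x∉ ∷ xs!) =
  All.map⁺ (All.tabulate λ y∈ eq → All.lookup x∉ y∈ (inj (here refl) (there y∈) eq))
  ∷ map⁺-local (λ x∈ y∈ → inj (there x∈) (there y∈)) xs!

card-≐ : X ≐ Y → HasCardinality Y n → HasCardinality X n
card-≐ (X⊆Y , Y⊆X) c = record
  { elements = C.elements
  ; unique   = C.unique
  ; complete = C.complete ⇔-∘ mk⇔ X⊆Y Y⊆X
  ; size     = C.size
  } where module C = HasCardinality c

card-∪ : (∀ {x} → x ∈ X → x ∉ Y) → HasCardinality X m → HasCardinality Y n → HasCardinality (X ∪ Y) (m ℕ.+ n)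
card-∪ disjoint p q = record
  { elements = P.elements ++ Q.elements
  ; unique   = Unique.++⁺ P.unique Q.unique
      λ (x∈p , x∈q) → disjoint (from P.complete x∈p) (from Q.complete x∈q)
  ; complete = mk⇔
      [ ∈-++⁺ˡ ∘ to P.complete , ∈-++⁺ʳ P.elements ∘ to Q.complete ]
      λ x∈ → [ inj₁ ∘ from P.complete , inj₂ ∘ from Q.complete ] (∈-++⁻ P.elements x∈)
  ; size     = trans (length-++ P.elements) (cong₂ ℕ._+_ P.size Q.size)
  } where
  module P = HasCardinality p
  module Q = HasCardinality q
  open Equivalence

-- Constructively a subset of a finite set need not be finite; decidability allows filtering the
-- enumeration.
card-⊆ : Decidable X → X ⊆ Y → HasCardinality Y n → ∃[ m ] HasCardinality X m
card-⊆ X? X⊆Y c = _ , record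
  { elements = filter X? C.elements
  ; unique   = Unique.filter⁺ X? C.unique
  ; complete = mk⇔ (λ x∈X → ∈-filter⁺ X? (to C.complete (X⊆Y x∈X)) x∈X)
                   (proj₂ ∘ ∈-filter⁻ X? {xs = C.elements})
  ; size     = refl
  } where
  module C = HasCardinality c
  open Equivalence

-- The size is given by an equation in ℤ, so that the empty interval with v = u - 1 is included and
-- no truncated subtraction appears.
card-⋯ : ∀ {u v} → + n ≡ v - u + 1ℤ → HasCardinality [ u ⋯ v ] n
card-⋯ {n} {u} {v} n≡ = record
  { elements = map (λ i → u + + i) (upTo n)
  ; unique   = Unique.map⁺ (λ {i} {j} eq → +-injective (+-cancelˡ u (+ i) (+ j) eq)) (Unique.upTo⁺ n)
  ; complete = mk⇔ ⇒ ⇐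
  ; size     = trans (length-map _ (upTo n)) (length-upTo n)
  }
  where
  ⇒ : ∀ {x} → x ∈ [ u ⋯ v ] → x ∈ˡ map (λ i → u + + i) (upTo n)
  ⇒ {x} (u≤x , x≤v) = subst (_∈ˡ map (λ i → u + + i) (upTo n)) (trans (cong (λ t → u + t) ∣x-u∣≡) (ident u x))
    (∈-map⁺ (λ i → u + + i) (∈-upTo⁺ (drop‿+<+ (i≤j-1⇒i<j (subst₂ _≤_ (sym ∣x-u∣≡) (cong (_- 1ℤ) (sym n≡))
      (≤-shift x≤v (ident₂ u v x)))))))
    where
    ∣x-u∣≡ : + ∣ x - u ∣ ≡ x - u
    ∣x-u∣≡ = 0≤i⇒+∣i∣≡i (i≤j⇒0≤j-i u≤x)
    ident : ∀ u x → u + (x - u) ≡ x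
    ident = solve-∀
    ident₂ : ∀ u v x → v - x ≡ v - u + 1ℤ - 1ℤ - (x - u)
    ident₂ = solve-∀
  ⇐ : ∀ {x} → x ∈ˡ map (λ i → u + + i) (upTo n) → x ∈ [ u ⋯ v ]
  ⇐ x∈ with i , i∈ , refl ← ∈-map⁻ (λ i → u + + i) x∈ =
      i≤i+j u (+ i)
    , ≤-shift (subst (+ i ≤_) (cong (_- 1ℤ) n≡) (i<j⇒i≤j-1 (+<+ (∈-upTo⁻ i∈)))) (ident u v (+ i))
    where
    ident : ∀ u v i → v - u + 1ℤ - 1ℤ - i ≡ v - (u + i)
    ident = solve-∀

card-bounded : ∀ u → Decidable X → X ⊆ 𝐍 → (∀ {x} → x ∈ X → x ≤ u) → ∃[ n ] HasCardinality X n
-- The bound `u` may be negative, in which case X is empty; replacing it by its absolute value gives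
-- an interval from 0 in every case.
card-bounded u X? X≥0 X≤u = card-⊆ X? (λ x∈X → X≥0 x∈X , ≤-trans (X≤u x∈X) (i≤+∣i∣ u))
  (card-⋯ {n = ∣ u ∣ ℕ.+ 1} (cong (_+ 1ℤ) (sym (+-identityʳ (+ ∣ u ∣)))))

card-⊕ : ∀ a b → (∀ {x y x′ y′} → y ∈ Y → y′ ∈ Y → a * x + b * y ≡ a * x′ + b * y′ → x ≡ x′ × y ≡ y′) →
  HasCardinality X m → HasCardinality Y n → HasCardinality (a · X ⊕ b · Y) (m ℕ.* n)
card-⊕ {Y = Y} {X = X} a b inj p q = record
  { elements = map f pairs
  ; unique   = map⁺-local
      (λ xy∈ xy′∈ eq → let (x≡ , y≡) = inj (Y-of xy∈) (Y-of xy′∈) eq in cong₂ _,_ x≡ y≡)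
      (Unique.cartesianProduct⁺ P.unique Q.unique)
  ; complete = mk⇔ ⇒ ⇐
  ; size     = trans (length-map f pairs) (trans (length-cartesianProduct P.elements Q.elements)
      (cong₂ ℕ._*_ P.size Q.size))
  }
  where
  module P = HasCardinality p
  module Q = HasCardinality q
  open Equivalence
  pairs : List (ℤ × ℤ)
  pairs = cartesianProduct P.elements Q.elements
  f : ℤ × ℤ → ℤ
  f (x , y) = a * x + b * y
  Y-of : ∀ {x y} → (x , y) ∈ˡ pairs → y ∈ Y
  Y-of = from Q.complete ∘ proj₂ ∘ ∈-cartesianProduct⁻ P.elements Q.elements
  ⇒ : ∀ {z} → z ∈ a · X ⊕ b · Y → z ∈ˡ map f pairs
  ⇒ (_ , _ , (x , x∈ , refl) , (y , y∈ , refl) , refl) =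
    ∈-map⁺ f (∈-cartesianProduct⁺ (to P.complete x∈) (to Q.complete y∈))
  ⇐ : ∀ {z} → z ∈ˡ map f pairs → z ∈ a · X ⊕ b · Y
  ⇐ z∈ with (x , y) , xy∈ , refl ← ∈-map⁻ f z∈ =
    let (x∈ , y∈) = ∈-cartesianProduct⁻ P.elements Q.elements xy∈ in
    _ , _ , (x , from P.complete x∈ , refl) , (y , from Q.complete y∈ , refl) , refl

-- Numerical semigroups

⟨⟩-0 : ∀ ns → 0ℤ ∈ ⟨ ns ⟩
⟨⟩-0 []       = refl
⟨⟩-0 (n ∷ ns) = _ , _ , (0ℤ , ≤-refl , refl) , ⟨⟩-0 ns , sym (trans (+-identityʳ (n * 0ℤ)) (*-zeroʳ n))

⟨⟩-+ : ∀ ns {x y} → x ∈ ⟨ ns ⟩ → y ∈ ⟨ ns ⟩ → x + y ∈ ⟨ ns ⟩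
⟨⟩-+ []       refl refl = refl
⟨⟩-+ (n ∷ ns) (_ , r , (j , 0≤j , refl) , r∈ , refl) (_ , s , (k , 0≤k , refl) , s∈ , refl) =
  _ , _ , (j + k , +-mono-≤ 0≤j 0≤k , refl) , ⟨⟩-+ ns r∈ s∈ , ident n j r k s
  where
  ident : ∀ n j r k s → n * j + r + (n * k + s) ≡ n * (j + k) + (r + s)
  ident = solve-∀

⟨⟩-* : ∀ ns {x k} → 0ℤ ≤ k → x ∈ ⟨ ns ⟩ → k * x ∈ ⟨ ns ⟩
⟨⟩-* []       {k = k} 0≤k refl = sym (*-zeroʳ k)
⟨⟩-* (n ∷ ns) {k = k} 0≤k (_ , r , (j , 0≤j , refl) , r∈ , refl) =
  _ , _ , (k * j , 0≤i*j 0≤k 0≤j , refl) , ⟨⟩-* ns 0≤k r∈ , ident n j r k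
  where
  ident : ∀ n j r k → k * (n * j + r) ≡ n * (k * j) + k * r
  ident = solve-∀

⟨⟩⊆𝐍 : ∀ {ns} → All Positive ns → ⟨ ns ⟩ ⊆ 𝐍
⟨⟩⊆𝐍 []         refl = ≤-refl
⟨⟩⊆𝐍 (n>0 ∷ ps) (_ , r , (k , 0≤k , refl) , r∈ , refl) =
  +-mono-≤ (0≤i*j (<⇒≤ (positive⁻¹ _ {{n>0}})) 0≤k) (⟨⟩⊆𝐍 ps r∈)

-- A bounded search suffices: the generator is at least 1 and the remaining summand is non-negative,
-- so the coefficient k of the first generator satisfies k ≤ z.
⟨⟩? : ∀ {ns} → All Positive ns → Decidable ⟨ ns ⟩
⟨⟩? []                       z = 0ℤ ≟ z
⟨⟩? {+[1+ n ] ∷ ns} (_ ∷ ps) z =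
  map′ ⇒ ⇐ (ℕ.anyUpTo? (λ k → ⟨⟩? ps (z - +[1+ n ] * + k)) (ℕ.suc ∣ z ∣))
  where
  ident : ∀ a k z → z ≡ a * k + (z - a * k)
  ident = solve-∀
  ident₂ : ∀ a k r → r ≡ a * k + r - a * k
  ident₂ = solve-∀
  ⇒ : (∃[ k ] k ℕ.< ℕ.suc ∣ z ∣ × z - +[1+ n ] * + k ∈ ⟨ ns ⟩) → z ∈ ⟨ +[1+ n ] ∷ ns ⟩
  ⇒ (k , _ , r∈) = _ , _ , (+ k , +≤+ z≤n , refl) , r∈ , ident +[1+ n ] (+ k) z
  ⇐ : z ∈ ⟨ +[1+ n ] ∷ ns ⟩ → ∃[ k ] k ℕ.< ℕ.suc ∣ z ∣ × z - +[1+ n ] * + k ∈ ⟨ ns ⟩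
  ⇐ (_ , r , (+ k , +≤+ _ , refl) , r∈ , refl) =
    k , s≤s (drop‿+≤+ (≤-trans k≤z (i≤+∣i∣ z))) , subst (_∈ ⟨ ns ⟩) (ident₂ +[1+ n ] (+ k) r) r∈
    where
    ident₃ : ∀ n k r → n * k + r - 0ℤ ≡ (1ℤ + n) * k + r - k
    ident₃ = solve-∀
    k≤z : + k ≤ z
    k≤z = ≤-shift (+-mono-≤ (0≤i*j {+ n} (+≤+ z≤n) (+≤+ z≤n)) (⟨⟩⊆𝐍 ps r∈)) (ident₃ (+ n) (+ k) r)

-- Bézout with the signs separated: ⟨ ns ⟩ admits only non-negative coefficients, so the negative
-- part of the combination is collected in `v`.
gcd-difference : ∀ {ns} → All Positive ns →
  ∃[ u ] ∃[ v ] u ∈ ⟨ ns ⟩ × v ∈ ⟨ ns ⟩ × + ∣ foldr gcd 0ℤ ns ∣ ≡ u - v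
gcd-difference [] = 0ℤ , 0ℤ , refl , refl , refl
gcd-difference {+[1+ n ] ∷ ns} (_ ∷ ps) with u , v , u∈ , v∈ , g≡ ← gcd-difference ps =
  combine (Bézout.identity (gcd-GCD (ℕ.suc n) g))
  where
  g : ℕ
  g = ∣ foldr gcd 0ℤ ns ∣
  member : ∀ x y {w} → w ∈ ⟨ ns ⟩ → +[1+ n ] * + x + + y * w ∈ ⟨ +[1+ n ] ∷ ns ⟩
  member x y w∈ = _ , _ , (+ x , +≤+ z≤n , refl) , ⟨⟩-* ns {k = + y} (+≤+ z≤n) w∈ , refl
  cast : ∀ {d} i j k l → d ℕ.+ i ℕ.* j ≡ k ℕ.* l → + d + + i * + j ≡ + k * + l
  cast {d} i j k l eq =
    trans (cong (λ t → + d + t) (sym (pos-* i j))) (trans (cong +_ eq) (pos-* k l))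
  isolate : ∀ d e → d ≡ d + e - e
  isolate = solve-∀
  combine : ∀ {d} → Bézout.Identity d (ℕ.suc n) g →
    ∃[ u ] ∃[ v ] u ∈ ⟨ +[1+ n ] ∷ ns ⟩ × v ∈ ⟨ +[1+ n ] ∷ ns ⟩ × + d ≡ u - v
  -- From d = x n - y g and g = u - v one gets d = (n x + y v) - y u; multiplying by -y exchanges
  -- the roles of `u` and `v`. The other case keeps them in place.
  combine {d} (Bézout.+- x y eq) = _ , _ , member x y v∈ , member 0 y u∈ , (begin
    + d                                                         ≡⟨ isolate (+ d) (+ y * + g) ⟩
    + d + + y * + g - + y * + g                                 ≡⟨ cong₂ (λ s t → s - + y * t) (cast y g x (ℕ.suc n) eq) g≡ ⟩
    + x * +[1+ n ] - + y * (u - v)                              ≡⟨ ident +[1+ n ] (+ x) (+ y) u v ⟩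
    +[1+ n ] * + x + + y * v - (+[1+ n ] * 0ℤ + + y * u)        ∎)
    where
    open ≡-Reasoning
    ident : ∀ n x y u v → x * n - y * (u - v) ≡ n * x + y * v - (n * 0ℤ + y * u)
    ident = solve-∀
  combine {d} (Bézout.-+ x y eq) = _ , _ , member 0 y u∈ , member x y v∈ , (begin
    + d                                                         ≡⟨ isolate (+ d) (+ x * +[1+ n ]) ⟩
    + d + + x * +[1+ n ] - + x * +[1+ n ]                       ≡⟨ cong (_- + x * +[1+ n ]) (cast x (ℕ.suc n) y g eq) ⟩
    + y * + g - + x * +[1+ n ]                                  ≡⟨ cong (λ t → + y * t - + x * +[1+ n ]) g≡ ⟩
    + y * (u - v) - + x * +[1+ n ]                              ≡⟨ ident +[1+ n ] (+ x) (+ y) u v ⟩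
    +[1+ n ] * 0ℤ + + y * u - (+[1+ n ] * + x + + y * v)        ∎)
    where
    open ≡-Reasoning
    ident : ∀ n x y u v → y * (u - v) - x * n ≡ n * 0ℤ + y * u - (n * x + y * v)
    ident = solve-∀

-- With u = v + 1 in the semigroup and z = q v + r, 0 ≤ r < v, one has
-- z = (q − r) v + r u, and q ≥ r as soon as z ≥ v².
conductor : ∀ {ns} → All Positive ns → foldr gcd 0ℤ ns ≡ 1ℤ → ∃[ c ] (∀ {z} → c ≤ z → z ∈ ⟨ ns ⟩)
conductor {ns} ps gcd≡1 with gcd-difference ps
... | u , -[1+ m ] , u∈ , v∈ , g≡ = contradiction (⟨⟩⊆𝐍 ps v∈) λ ()
-- With v = 0 there is no division by v, but then u = 1 and every non-negative z is a multiple of u.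
... | u , + 0      , u∈ , v∈ , g≡ = 0ℤ , λ {z} 0≤z → subst (_∈ ⟨ ns ⟩) (z*u≡z z) (⟨⟩-* ns 0≤z u∈)
  where
  z*u≡z : ∀ z → z * u ≡ z
  z*u≡z z = trans (cong (z *_) (trans (sym (+-identityʳ u)) (trans (sym g≡) (cong (λ t → + ∣ t ∣) gcd≡1))))
    (*-identityʳ z)
... | u , v@(+[1+ m ]) , u∈ , v∈ , g≡ = v * v , above
  where
  1≡u-v : 1ℤ ≡ u - v
  1≡u-v = trans (sym (cong (λ t → + ∣ t ∣) gcd≡1)) g≡
  above : ∀ {z} → v * v ≤ z → z ∈ ⟨ ns ⟩
  above {z} v²≤z = subst (_∈ ⟨ ns ⟩) (sym z≡) (⟨⟩-+ ns (⟨⟩-* ns (i≤j⇒0≤j-i r≤q) v∈) (⟨⟩-* ns {k = r} (+≤+ z≤n) u∈))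
    where
    q r : ℤ
    q = z /ℕ ℕ.suc m
    r = + (z %ℕ ℕ.suc m)
    division : z ≡ r + q * v
    division = a≡a%ℕn+[a/ℕn]*n z (ℕ.suc m)
    r<v : r < v
    r<v = +<+ (n%ℕd<d z (ℕ.suc m))
    ident : ∀ v r w → r + w + (v - 1ℤ) - (v * v + r) ≡ w - 1ℤ - (v - 1ℤ) * v
    ident = solve-∀
    -- As r ≤ v - 1, the bound v² ≤ r + q v leaves q v > (v - 1) v; cancelling v gives r ≤ v - 1 <
    -- q.
    [v-1]v<qv : (v - 1ℤ) * v < q * v
    [v-1]v<qv = i≤j-1⇒i<j
      (≤-shift (+-mono-≤ (subst (v * v ≤_) division v²≤z) (i<j⇒i≤j-1 r<v)) (ident v r (q * v)))
    r≤q : r ≤ q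
    r≤q = ≤-trans (i<j⇒i≤j-1 r<v) (<⇒≤ (*-cancelʳ-<-nonNeg v [v-1]v<qv))
    ident₁ : ∀ v q r → r + q * v ≡ r + q * v + r * (1ℤ - 1ℤ)
    ident₁ = solve-∀
    ident₂ : ∀ u v q r → r + q * v + r * (u - v - 1ℤ) ≡ (q - r) * v + r * u
    ident₂ = solve-∀
    z≡ : z ≡ (q - r) * v + r * u
    -- A vanishing term r (1 - 1) is inserted so that rewriting its first 1 as u - v trades r copies
    -- of v for r copies of u.
    z≡ = begin
      z                               ≡⟨ division ⟩
      r + q * v                       ≡⟨ ident₁ v q r ⟩
      r + q * v + r * (1ℤ - 1ℤ)       ≡⟨ cong (λ t → r + q * v + r * (t - 1ℤ)) 1≡u-v ⟩
      r + q * v + r * (u - v - 1ℤ)    ≡⟨ ident₂ u v q r ⟩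
      (q - r) * v + r * u             ∎
      where open ≡-Reasoning

-- Representations a₁ x + a₂ y with 0 ≤ y < a₁

module Gluing {Γ Γ₁ : ℤSet} {a₁ a₂ : ℤ} (gluing : IsGluing Γ a₁ Γ₁ a₂ 𝐍) (0<a₁ : 0ℤ < a₁) where
  open IsGluing gluing

  private
    instance
      a₁-nonZero : NonZero a₁
      a₁-nonZero = >-nonZero 0<a₁

    variable
      c x y x′ y′ : ℤ

  -- By coprimality a₁ divides y′ - y, and t is the quotient. The bounds are deliberately one-sided,
  -- so that the primed representation may be any one with y′ ≥ 0.
  exchange : y < a₁ → 0ℤ ≤ y′ → a₁ * x + a₂ * y ≡ a₁ * x′ + a₂ * y′ →
    ∃[ t ] 0ℤ ≤ t × x ≡ x′ + t * a₂ × y′ ≡ y + t * a₁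
  exchange {y} {y′} {x} {x′} y<a₁ 0≤y′ eq = t , 0≤t , x≡ , y′≡
    where
    open ≡-Reasoning
    expand : ∀ a b x y y′ → b * (y′ - y) ≡ a * x + b * y′ - a * x - b * y
    expand = solve-∀
    collect : ∀ a b x y x′ → a * x + b * y - a * x′ - b * y ≡ (x - x′) * a
    collect = solve-∀
    a₂[y′-y]≡ : a₂ * (y′ - y) ≡ (x - x′) * a₁
    a₂[y′-y]≡ = begin
      a₂ * (y′ - y)                               ≡⟨ expand a₁ a₂ x′ y y′ ⟩
      a₁ * x′ + a₂ * y′ - a₁ * x′ - a₂ * y        ≡⟨ cong (λ w → w - a₁ * x′ - a₂ * y) eq ⟨
      a₁ * x + a₂ * y - a₁ * x′ - a₂ * y          ≡⟨ collect a₁ a₂ x y x′ ⟩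
      (x - x′) * a₁                               ∎
    a₁∣y′-y : a₁ ∣ y′ - y
    a₁∣y′-y = ∣ᵤ⇒∣ (coprime-divisor a₁ a₂ (y′ - y) (gcd≡1⇒coprime (+-injective coprime))
      (∣⇒∣ᵤ (divides (x - x′) a₂[y′-y]≡)))
    t : ℤ
    t = _∣_.quotient a₁∣y′-y
    y′-y≡ : y′ - y ≡ t * a₁
    y′-y≡ = _∣_.equality a₁∣y′-y
    restore : ∀ p q → q ≡ p + (q - p)
    restore = solve-∀
    y′≡ : y′ ≡ y + t * a₁
    y′≡ = trans (restore y y′) (cong (λ w → y + w) y′-y≡)
    swap : ∀ a b t → b * (t * a) ≡ t * b * a
    swap = solve-∀
    x-x′≡ : x - x′ ≡ t * a₂
    x-x′≡ = *-cancelʳ-≡ _ _ a₁ (begin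
      (x - x′) * a₁      ≡⟨ a₂[y′-y]≡ ⟨
      a₂ * (y′ - y)      ≡⟨ cong (a₂ *_) y′-y≡ ⟩
      a₂ * (t * a₁)      ≡⟨ swap a₁ a₂ t ⟩
      t * a₂ * a₁        ∎)
    x≡ : x ≡ x′ + t * a₂
    x≡ = trans (restore x′ x) (cong (λ w → x′ + w) x-x′≡)
    difference : ∀ a y w → a + (y + w) - (y + 0ℤ) ≡ w - -1ℤ * a
    difference = solve-∀
    -- Here t a₁ = y′ - y exceeds -a₁ because y′ ≥ 0 and y < a₁; hence t > -1, which for integers
    -- means t ≥ 0.
    -a₁<ta₁ : -1ℤ * a₁ < t * a₁
    -a₁<ta₁ = <-shift (+-mono-<-≤ y<a₁ (subst (0ℤ ≤_) y′≡ 0≤y′)) (difference a₁ y (t * a₁))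
    0≤t : 0ℤ ≤ t
    0≤t = i<j⇒suc[i]≤j (*-cancelʳ-<-nonNeg { -1ℤ} {t} a₁ {{nonNegative (<⇒≤ 0<a₁)}} -a₁<ta₁)

  -- A reduced second coordinate is the least non-negative one. Applied in both directions, this
  -- gives uniqueness of reduced representations.
  exchange-≤ : y < a₁ → 0ℤ ≤ y′ → a₁ * x + a₂ * y ≡ a₁ * x′ + a₂ * y′ → y ≤ y′
  exchange-≤ {y} {y′} {x} {x′} y<a₁ 0≤y′ eq =
    let (t , 0≤t , _ , y′≡) = exchange {x = x} {x′} y<a₁ 0≤y′ eq
    in subst (y ≤_) (sym y′≡) (≤-shift (0≤i*j 0≤t (<⇒≤ 0<a₁)) (ident y (t * a₁)))
    where
    ident : ∀ y w → w - 0ℤ ≡ y + w - y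
    ident = solve-∀

  representation-unique : 0ℤ ≤ y → y < a₁ → 0ℤ ≤ y′ → y′ < a₁ →
    a₁ * x + a₂ * y ≡ a₁ * x′ + a₂ * y′ → x ≡ x′ × y ≡ y′
  representation-unique {y} {y′} {x} {x′} 0≤y y<a₁ 0≤y′ y′<a₁ eq =
      *-cancelˡ-≡ a₁ x x′ (+-cancelʳ (a₂ * y) _ _
        (trans eq (cong (λ w → a₁ * x′ + a₂ * w) (sym y≡y′))))
    , y≡y′
    where
    y≡y′ : y ≡ y′
    y≡y′ = ≤-antisym (exchange-≤ {x = x} {x′} y<a₁ 0≤y′ eq) (exchange-≤ {x = x′} {x} y′<a₁ 0≤y (sym eq))

  representation : c ∈ Γ → ∃[ x ] ∃[ y ] 0ℤ ≤ y × y < a₁ × c ≡ a₁ * x + a₂ * y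
  representation c∈Γ with _ , _ , (x , _ , refl) , (y , _ , refl) , refl ← proj₁ isSum c∈Γ =
    -- Division of y by a₁ leaves the remainder as second coordinate; the multiple of a₁ a₂ is moved
    -- into the first.
    x + a₂ * (y / a₁) , + (y % a₁) , +≤+ z≤n ,
    subst (+ (y % a₁) <_) (0≤i⇒+∣i∣≡i (<⇒≤ 0<a₁)) (+<+ (n%d<d y a₁)) ,
    trans (cong (λ w → a₁ * x + a₂ * w) (a≡a%n+[a/n]*n y a₁)) (ident a₁ a₂ x (+ (y % a₁)) (y / a₁))
    where
    ident : ∀ a b x r q → a * x + b * (r + q * a) ≡ a * (x + b * q) + b * r
    ident = solve-∀

  -- Membership in Γ₁, and finiteness of its Apéry sets and sets of divisors

  private
    ns : List ℤ
    ns = proj₁ isNumericalSemigroup₁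

    ns>0 : All Positive ns
    ns>0 = proj₁ (proj₂ isNumericalSemigroup₁)

    gcd-ns≡1 : foldr gcd 0ℤ ns ≡ 1ℤ
    gcd-ns≡1 = proj₁ (proj₂ (proj₂ isNumericalSemigroup₁))

    Γ₁≐⟨ns⟩ : Γ₁ ≐ ⟨ ns ⟩
    Γ₁≐⟨ns⟩ = proj₂ (proj₂ (proj₂ isNumericalSemigroup₁))

  Γ₁? : Decidable Γ₁
  Γ₁? x = map′ (proj₂ Γ₁≐⟨ns⟩) (proj₁ Γ₁≐⟨ns⟩) (⟨⟩? ns>0 x)

  Γ₁⊆𝐍 : Γ₁ ⊆ 𝐍
  Γ₁⊆𝐍 = ⟨⟩⊆𝐍 ns>0 ∘ proj₁ Γ₁≐⟨ns⟩

  -- Since `c` is an arbitrary integer, the criterion serves for c itself as well as for the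
  -- differences c - z and z - c. The forward direction uses `exchange`: x arises from an element of
  -- Γ₁ by adding a₂ ∈ Γ₁ non-negatively often.
  ∈Γ⇔∈Γ₁ : c ≡ a₁ * x + a₂ * y → 0ℤ ≤ y → y < a₁ → c ∈ Γ ⇔ x ∈ Γ₁
  ∈Γ⇔∈Γ₁ {c} {x} {y} c≡ 0≤y y<a₁ = mk⇔ ⇒ ⇐
    where
    ⇒ : c ∈ Γ → x ∈ Γ₁
    ⇒ c∈Γ with _ , _ , (x′ , x′∈ , refl) , (y′ , 0≤y′ , refl) , eq ← proj₁ isSum c∈Γ =
      let (t , 0≤t , x≡ , _) = exchange {x = x} {x′} y<a₁ 0≤y′ (trans (sym c≡) eq)
      in subst Γ₁ (sym x≡)
        (proj₂ Γ₁≐⟨ns⟩ (⟨⟩-+ ns (proj₁ Γ₁≐⟨ns⟩ x′∈) (⟨⟩-* ns 0≤t (proj₁ Γ₁≐⟨ns⟩ a₂∈Γ₁))))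
    ⇐ : x ∈ Γ₁ → c ∈ Γ
    ⇐ x∈ = proj₂ isSum (_ , _ , (x , x∈ , refl) , (y , 0≤y , refl) , c≡)

  -- From the conductor `F` on, every integer lies in Γ₁, so a - w ∉ Γ₁ bounds a by F + w.
  Ap-finite : ∀ w → ∃[ n ] HasCardinality (Ap Γ₁ w) n
  Ap-finite w = card-bounded (F + w) (λ a → Γ₁? a ×-dec ¬? (Γ₁? (a - w))) (Γ₁⊆𝐍 ∘ proj₁) bound
    where
    F : ℤ
    F = proj₁ (conductor ns>0 gcd-ns≡1)
    ident : ∀ a w F → a - (F + w) ≡ a - w - F
    ident = solve-∀
    bound : ∀ {a} → a ∈ Ap Γ₁ w → a ≤ F + w
    bound {a} (_ , a-w∉) = ≮⇒≥ λ F+w<a → a-w∉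
      (proj₂ Γ₁≐⟨ns⟩ (proj₂ (conductor ns>0 gcd-ns≡1) (≤-shift (<⇒≤ F+w<a) (ident a w F))))

  D-finite : ∀ w → ∃[ n ] HasCardinality (D Γ₁ w) n
  D-finite w = card-bounded w (λ a → Γ₁? a ×-dec Γ₁? (w - a)) (Γ₁⊆𝐍 ∘ proj₁)
    λ (_ , w-a∈) → 0≤i-j⇒j≤i (Γ₁⊆𝐍 w-a∈)

  -- The common shape of all four claims: fibres X₀ over y < s and X₁ over s ≤ y.
  module Split {s : ℤ} (0≤s : 0ℤ ≤ s) (s≤a₁ : s ≤ a₁) where

    Fibred : ℤSet → ℤSet → ℤSet
    Fibred X₀ X₁ = (a₁ · X₀ ⊕ a₂ · [ 0ℤ ⋯ s - 1ℤ ]) ∪ (a₁ · X₁ ⊕ a₂ · [ s ⋯ a₁ - 1ℤ ])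

    -- Testing reduced representations is enough, because Y ⊆ Γ provides one for each element of Y.
    fibred : Y ⊆ Γ →
      (∀ {x y} → 0ℤ ≤ y → y < s → (a₁ * x + a₂ * y ∈ Y) ⇔ x ∈ X₀) →
      (∀ {x y} → s ≤ y → y < a₁ → (a₁ * x + a₂ * y ∈ Y) ⇔ x ∈ X₁) →
      Y ≐ Fibred X₀ X₁
    fibred {Y} {X₀} {X₁} Y⊆Γ low high = ⇒ , ⇐
      where
      open Equivalence
      ⇒ : Y ⊆ Fibred X₀ X₁
      ⇒ c∈Y with x , y , 0≤y , y<a₁ , refl ← representation (Y⊆Γ c∈Y) with y <? s
      ... | yes y<s = inj₁ (_ , _ , (x , to (low 0≤y y<s) c∈Y , refl) , (y , (0≤y , i<j⇒i≤j-1 y<s) , refl) , refl)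
      ... | no  y≮s = inj₂ (_ , _ , (x , to (high (≮⇒≥ y≮s) y<a₁) c∈Y , refl)
                                  , (y , (≮⇒≥ y≮s , i<j⇒i≤j-1 y<a₁) , refl) , refl)
      ⇐ : Fibred X₀ X₁ ⊆ Y
      ⇐ (inj₁ (_ , _ , (x , x∈ , refl) , (y , (0≤y , y≤) , refl) , refl)) = from (low 0≤y (i≤j-1⇒i<j y≤)) x∈
      ⇐ (inj₂ (_ , _ , (x , x∈ , refl) , (y , (s≤y , y≤) , refl) , refl)) = from (high s≤y (i≤j-1⇒i<j y≤)) x∈

    -- Uniqueness of reduced representations acts twice: within a piece it makes the elements
    -- correspond to pairs (x, y), and across the pieces it gives disjointness, y being on one side
    -- of `s` only.
    card-Fibred : HasCardinality X₀ k → HasCardinality X₁ l →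
      ∃[ n ] HasCardinality (Fibred X₀ X₁) n × + n ≡ s * + k + (a₁ - s) * + l
    card-Fibred {k = k} {l = l} p q =
      k ℕ.* ∣ s ∣ ℕ.+ l ℕ.* ∣ a₁ - s ∣ , card-∪ disjoint
        (card-⊕ a₁ a₂ (λ {x} {y} {x′} {y′} y∈ y′∈ → unique {y} {y′} {x} {x′} (low y∈) (low y′∈)) p (card-⋯ (trans ∣s∣≡ (ident₀ s))))
        (card-⊕ a₁ a₂ (λ {x} {y} {x′} {y′} y∈ y′∈ → unique {y} {y′} {x} {x′} (high y∈) (high y′∈)) q (card-⋯ (trans ∣a₁-s∣≡ (ident₁ a₁ s)))) ,
      (begin
        + (k ℕ.* ∣ s ∣) + + (l ℕ.* ∣ a₁ - s ∣)     ≡⟨ cong₂ _+_ (pos-* k ∣ s ∣) (pos-* l ∣ a₁ - s ∣) ⟩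
        + k * + ∣ s ∣ + + l * + ∣ a₁ - s ∣         ≡⟨ cong₂ (λ u v → + k * u + + l * v) ∣s∣≡ ∣a₁-s∣≡ ⟩
        + k * s + + l * (a₁ - s)                   ≡⟨ cong₂ _+_ (*-comm (+ k) s) (*-comm (+ l) (a₁ - s)) ⟩
        s * + k + (a₁ - s) * + l                   ∎)
      where
      open ≡-Reasoning
      ∣s∣≡ : + ∣ s ∣ ≡ s
      ∣s∣≡ = 0≤i⇒+∣i∣≡i 0≤s
      ∣a₁-s∣≡ : + ∣ a₁ - s ∣ ≡ a₁ - s
      ∣a₁-s∣≡ = 0≤i⇒+∣i∣≡i (i≤j⇒0≤j-i s≤a₁)
      ident₀ : ∀ s → s ≡ s - 1ℤ - 0ℤ + 1ℤ
      ident₀ = solve-∀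
      ident₁ : ∀ a s → a - s ≡ a - 1ℤ - s + 1ℤ
      ident₁ = solve-∀
      low : y ∈ [ 0ℤ ⋯ s - 1ℤ ] → 0ℤ ≤ y × y < a₁
      low (0≤y , y≤s-1) = 0≤y , <-≤-trans (i≤j-1⇒i<j y≤s-1) s≤a₁
      high : y ∈ [ s ⋯ a₁ - 1ℤ ] → 0ℤ ≤ y × y < a₁
      high (s≤y , y≤a₁-1) = ≤-trans 0≤s s≤y , i≤j-1⇒i<j y≤a₁-1
      unique : 0ℤ ≤ y × y < a₁ → 0ℤ ≤ y′ × y′ < a₁ → a₁ * x + a₂ * y ≡ a₁ * x′ + a₂ * y′ → x ≡ x′ × y ≡ y′
      unique {y} {y′} {x} {x′} (0≤y , y<a₁) (0≤y′ , y′<a₁) =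
        representation-unique {y} {y′} {x} {x′} 0≤y y<a₁ 0≤y′ y′<a₁
      disjoint : c ∈ a₁ · X₀ ⊕ a₂ · [ 0ℤ ⋯ s - 1ℤ ] → c ∉ a₁ · X₁ ⊕ a₂ · [ s ⋯ a₁ - 1ℤ ]
      disjoint (_ , _ , (x , _ , refl) , (y , y∈ , refl) , refl)
               (_ , _ , (x′ , _ , refl) , (y′ , y′∈ , refl) , eq)
        = <⇒≱ (i≤j-1⇒i<j (proj₂ y∈))
            (subst (s ≤_) (sym (proj₂ (unique {y} {y′} {x} {x′} (low y∈) (high y′∈) eq))) (proj₁ y′∈))

  -- The Apéry set and the divisors of z = a₁ α + a₂ β

  module _ (α β : ℤ) (0≤β : 0ℤ ≤ β) (β<a₁ : β < a₁) where

    private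
      z : ℤ
      z = a₁ * α + a₂ * β

    -- c − z and z − c are brought to the normal form a₁ x + a₂ y, 0 ≤ y < a₁, by
    -- moving a₁ a₂ between the two terms when y would be negative.
    Ap-low : 0ℤ ≤ y → y < β → (a₁ * x + a₂ * y ∈ Ap Γ z) ⇔ x ∈ Ap Γ₁ (α + a₂)
    Ap-low {y} {x} 0≤y y<β = ∈Γ⇔∈Γ₁ refl 0≤y (<-trans y<β β<a₁) ×-⇔ ¬-cong-⇔ (∈Γ⇔∈Γ₁ (ident a₁ a₂ x y α β)
      (≤-shift (+-mono-≤ 0≤y (<⇒≤ β<a₁)) (ident₁ a₁ y β))
      (<-shift y<β (ident₂ a₁ y β)))
      where
      ident : ∀ a b x y α β → a * x + b * y - (a * α + b * β) ≡ a * (x - (α + b)) + b * (y - β + a)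
      ident = solve-∀
      ident₁ : ∀ a y β → y + a - (0ℤ + β) ≡ y - β + a - 0ℤ
      ident₁ = solve-∀
      ident₂ : ∀ a y β → β - y ≡ a - (y - β + a)
      ident₂ = solve-∀

    Ap-high : β ≤ y → y < a₁ → (a₁ * x + a₂ * y ∈ Ap Γ z) ⇔ x ∈ Ap Γ₁ α
    Ap-high {y} {x} β≤y y<a₁ = ∈Γ⇔∈Γ₁ refl (≤-trans 0≤β β≤y) y<a₁ ×-⇔ ¬-cong-⇔ (∈Γ⇔∈Γ₁ (ident a₁ a₂ x y α β)
      (i≤j⇒0≤j-i β≤y)
      (<-shift (+-mono-<-≤ y<a₁ 0≤β) (ident₁ a₁ y β)))
      where
      ident : ∀ a b x y α β → a * x + b * y - (a * α + b * β) ≡ a * (x - α) + b * (y - β)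
      ident = solve-∀
      ident₁ : ∀ a y β → a + β - (y + 0ℤ) ≡ a - (y - β)
      ident₁ = solve-∀

    D-low : 0ℤ ≤ y → y < β + 1ℤ → (a₁ * x + a₂ * y ∈ D Γ z) ⇔ x ∈ D Γ₁ α
    D-low {y} {x} 0≤y y<β+1 = ∈Γ⇔∈Γ₁ refl 0≤y (≤-<-trans y≤β β<a₁) ×-⇔ ∈Γ⇔∈Γ₁ (ident a₁ a₂ x y α β)
      (i≤j⇒0≤j-i y≤β)
      (<-shift (+-mono-<-≤ β<a₁ 0≤y) (ident₁ a₁ y β))
      where
      ident : ∀ a b x y α β → a * α + b * β - (a * x + b * y) ≡ a * (α - x) + b * (β - y)
      ident = solve-∀
      ident₁ : ∀ a y β → a + y - (β + 0ℤ) ≡ a - (β - y)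
      ident₁ = solve-∀
      ident₂ : ∀ y β → β + 1ℤ - 1ℤ - y ≡ β - y
      ident₂ = solve-∀
      y≤β : y ≤ β
      y≤β = ≤-shift (i<j⇒i≤j-1 y<β+1) (ident₂ y β)

    D-high : β + 1ℤ ≤ y → y < a₁ → (a₁ * x + a₂ * y ∈ D Γ z) ⇔ x ∈ D Γ₁ (α - a₂)
    D-high {y} {x} β+1≤y y<a₁ = ∈Γ⇔∈Γ₁ refl 0≤y y<a₁ ×-⇔ ∈Γ⇔∈Γ₁ (ident a₁ a₂ x y α β)
      (≤-shift (+-mono-≤ (<⇒≤ y<a₁) 0≤β) (ident₁ a₁ y β))
      (i≤j-1⇒i<j (≤-shift β+1≤y (ident₂ a₁ y β)))
      where
      ident : ∀ a b x y α β → a * α + b * β - (a * x + b * y) ≡ a * (α - b - x) + b * (β - y + a)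
      ident = solve-∀
      ident₁ : ∀ a y β → a + β - (y + 0ℤ) ≡ β - y + a - 0ℤ
      ident₁ = solve-∀
      ident₂ : ∀ a y β → y - (β + 1ℤ) ≡ a - 1ℤ - (β - y + a)
      ident₂ = solve-∀
      0≤y : 0ℤ ≤ y
      0≤y = ≤-trans (+-mono-≤ 0≤β (+≤+ z≤n)) β+1≤y

    private
      -- The cut lies where a multiple of a₁ must be borrowed. At y = β neither difference needs it;
      -- for the Apéry set this y belongs to the upper range, for the divisors to the lower one,
      -- whence the cuts β and β + 1. The latter may equal a₁, leaving the upper range empty.
      module Apˢ = Split 0≤β (<⇒≤ β<a₁)
      module Dˢ = Split {β + 1ℤ} (+-mono-≤ 0≤β (+≤+ z≤n))
        (subst (_≤ a₁) (+-comm 1ℤ β) (i<j⇒suc[i]≤j β<a₁))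

    Ap-fibred : Ap Γ z ≐ Apˢ.Fibred (Ap Γ₁ (α + a₂)) (Ap Γ₁ α)
    Ap-fibred = Apˢ.fibred proj₁ Ap-low Ap-high

    D-fibred : D Γ z ≐ Dˢ.Fibred (D Γ₁ α) (D Γ₁ (α - a₂))
    D-fibred = Dˢ.fibred proj₁ D-low D-high

    card-Ap : ∃[ n ] ∃[ k ] ∃[ l ]
      HasCardinality (Ap Γ z) n × HasCardinality (Ap Γ₁ (α + a₂)) k × HasCardinality (Ap Γ₁ α) l
      × + n ≡ β * + k + (a₁ - β) * + l
    card-Ap =
      let (k , p) = Ap-finite (α + a₂)
          (l , q) = Ap-finite α
          (n , r , n≡) = Apˢ.card-Fibred p q
      in n , k , l , card-≐ Ap-fibred r , p , q , n≡

    card-D : ∃[ n ] ∃[ k ] ∃[ l ]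
      HasCardinality (D Γ z) n × HasCardinality (D Γ₁ α) k × HasCardinality (D Γ₁ (α - a₂)) l
      × + n ≡ (β + 1ℤ) * + k + (a₁ - β - 1ℤ) * + l
    card-D =
      let (k , p) = D-finite α
          (l , q) = D-finite (α - a₂)
          (n , r , n≡) = Dˢ.card-Fibred p q
      in n , k , l , card-≐ D-fibred r , p , q
         , trans n≡ (cong (λ w → (β + 1ℤ) * + k + w * + l) (ident a₁ β))
      where
      ident : ∀ a β → a - (β + 1ℤ) ≡ a - β - 1ℤ
      ident = solve-∀

theorem12 : ∀ {Γ Γ₁ : ℤSet} {a₁ a₂ : ℤ} → IsGluing Γ a₁ Γ₁ a₂ 𝐍 →
  ∀ (z α β : ℤ) → z ≡ a₁ * α + a₂ * β → 0ℤ ≤ β → β < a₁ →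
  (Ap Γ z ≐ (a₁ · Ap Γ₁ (α + a₂) ⊕ a₂ · [ 0ℤ ⋯ β - 1ℤ ])
          ∪ (a₁ · Ap Γ₁ α ⊕ a₂ · [ β ⋯ a₁ - 1ℤ ]))
  × (D Γ z ≐ (a₁ · D Γ₁ α ⊕ a₂ · [ 0ℤ ⋯ β ])
           ∪ (a₁ · D Γ₁ (α - a₂) ⊕ a₂ · [ β + 1ℤ ⋯ a₁ - 1ℤ ]))
  × (∃[ n ] ∃[ k ] ∃[ l ]
       HasCardinality (Ap Γ z) n
       × HasCardinality (Ap Γ₁ (α + a₂)) k
       × HasCardinality (Ap Γ₁ α) l
       × + n ≡ β * + k + (a₁ - β) * + l)
  × (∃[ n ] ∃[ k ] ∃[ l ]
       HasCardinality (D Γ z) n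
       × HasCardinality (D Γ₁ α) k
       × HasCardinality (D Γ₁ (α - a₂)) l
       × + n ≡ (β + 1ℤ) * + k + (a₁ - β - 1ℤ) * + l)
theorem12 {Γ} {Γ₁} {a₁} {a₂} gluing _ α β refl 0≤β β<a₁ =
    Ap-fibred α β 0≤β β<a₁
  -- The cut β + 1 yields the upper end β + 1 - 1, which is only propositionally β.
  , subst (λ v → D Γ (a₁ * α + a₂ * β) ≐ (a₁ · D Γ₁ α ⊕ a₂ · [ 0ℤ ⋯ v ])
                                       ∪ (a₁ · D Γ₁ (α - a₂) ⊕ a₂ · [ β + 1ℤ ⋯ a₁ - 1ℤ ]))
      (ident β) (D-fibred α β 0≤β β<a₁)
  , card-Ap α β 0≤β β<a₁
  , card-D α β 0≤β β<a₁
  where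
  -- Positivity of a₁ comes from the range 0 ≤ β < a₁.
  open Gluing gluing (≤-<-trans 0≤β β<a₁)
  ident : ∀ β → β + 1ℤ - 1ℤ ≡ β
  ident = solve-∀
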